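{- Let $G$ be a finite connected graph with minimum degree $\delta(G)\geq 2$. Then either $G^2$ is maximally edge-connected, or \[ \lambda(G^2) \geq \kappa(G)\,(\delta(G)+1). \]
   Context: All graphs are finite and simple. The square $G^2$ of $G$ is the graph on $V(G)$ in which two distinct vertices are adjacent if and only if their distance in $G$ is at most $2$. $\lambda(H)$ denotes the edge-connectivity of $H$ (minimum number of edges whose removal disconnects $H$), $\kappa(G)$ the (vertex-)connectivity of $G$ (minimum number of vertices whose removal disconnects $G$), and $\delta(G)$ the minimum degree. A graph is maximally edge-connected if its edge-connectivity equals its minimum degree. -}

module Defs where

open import Data.Nat using (ℕ; zero; suc; _+_; _*_; _∸_; _≤_)
open import Data.Nat.Base using (_<ᵇ_)
open import Data.Bool using (Bool; true; false; _∧_; _∨_; not; if_then_else_)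
open import Data.Fin using (Fin; toℕ; _≟_)
import Data.Fin as F
open import Data.List using (allFin)
open import Data.Bool.ListAction using (any)
open import Data.Product using (Σ; _×_; ∃)
open import Data.Sum using (_⊎_)
open import Relation.Nullary using (¬_)
open import Relation.Nullary.Decidable using (⌊_⌋)
open import Relation.Binary.PropositionalEquality using (_≡_)

Adj : ℕ → Set
Adj n = Fin n → Fin n → Bool

record Graph (n : ℕ) : Set where
  field
    adj    : Adj n
    sym    : ∀ u v → adj u v ≡ adj v u
    irrefl : ∀ u → adj u u ≡ false
open Graph public

countB : ∀ {n} → (Fin n → Bool) → ℕ
countB {zero}  p = 0
countB {suc n} p = (if p F.zero then 1 else 0) + countB (λ i → p (F.suc i))

deg : ∀ {n} → Adj n → Fin n → ℕ
deg A u = countB (λ v → A u v)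

IsMinDeg : ∀ {n} → Adj n → ℕ → Set
IsMinDeg A d = (∃ λ u → deg A u ≡ d) × (∀ v → d ≤ deg A v)

data Reach {n : ℕ} (E : Fin n → Fin n → Set) : Fin n → Fin n → Set where
  here : ∀ {u} → Reach E u u
  step : ∀ {u w v} → E u w → Reach E w v → Reach E u v

Connected : ∀ {n} → Adj n → Set
Connected A = ∀ u v → Reach (λ x y → A x y ≡ true) u v

square : ∀ {n} → Adj n → Adj n
square {n} A u v =
  not ⌊ u ≟ v ⌋ ∧ (A u v ∨ any (λ w → A u w ∧ A w v) (allFin n))

IsEdgeSet : ∀ {n} → Adj n → Adj n → Set
IsEdgeSet A R = (∀ u v → R u v ≡ true → A u v ≡ true) × (∀ u v → R u v ≡ R v u)

edgeCount : ∀ {n} → Adj n → ℕ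
edgeCount {n} R = sumF (λ u → countB (λ v → R u v ∧ (toℕ u <ᵇ toℕ v)))
  where
  sumF : ∀ {m} → (Fin m → ℕ) → ℕ
  sumF {zero}  f = 0
  sumF {suc m} f = f F.zero + sumF (λ i → f (F.suc i))

removeEdges : ∀ {n} → Adj n → Adj n → Adj n
removeEdges A R u v = A u v ∧ not (R u v)

IsEdgeConn : ∀ {n} → Adj n → ℕ → Set
IsEdgeConn A l =
  (Σ (Adj _) λ R → IsEdgeSet A R × edgeCount R ≡ l × ¬ Connected (removeEdges A R))
  × (∀ R → IsEdgeSet A R → ¬ Connected (removeEdges A R) → l ≤ edgeCount R)

MaxEdgeConnected : ∀ {n} → Adj n → Set
MaxEdgeConnected A = Σ ℕ λ d → IsMinDeg A d × IsEdgeConn A d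

ReachAvoiding : ∀ {n} → Adj n → (Fin n → Bool) → Fin n → Fin n → Set
ReachAvoiding A S = Reach (λ x y → (A x y ≡ true) × (S x ≡ false) × (S y ≡ false))

-- S is a separating set: A − S is disconnected or has at most one vertex
-- (standard convention, so that κ(K_n) = n − 1)
Separates : ∀ {n} → Adj n → (Fin n → Bool) → Set
Separates {n} A S =
  (Σ (Fin n) λ u → Σ (Fin n) λ v → (S u ≡ false) × (S v ≡ false) × ¬ ReachAvoiding A S u v)
  ⊎ (n ∸ countB S ≤ 1)

IsVertexConn : ∀ {n} → Adj n → ℕ → Set
IsVertexConn A k =
  (Σ (Fin _ → Bool) λ S → countB S ≡ k × Separates A S)
  × (∀ S → Separates A S → k ≤ countB S)

{-# OPTIONS --safe #-}
module Submission where

-- Let (X, Y) be the sides of a minimum edge cut of the square H, and suppose it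
-- has fewer edges than the minimum degree of H. Then some x in X and some y in Y
-- carry no edge of the cut. Let the load of a vertex be its number of cut edges.
-- On a walk from x to y let w → z be the first step from X to Y, with u the
-- vertex before w, and p → q the last such step followed by a vertex r of Y.
-- Every neighbour of w, and w itself, is joined in H to u or z by a cut edge, so
-- the loads of u and z add up to at least d + 1; so do those of p and r. These
-- four positions on the walk are distinct, hence every walk from x to y has
-- total load at least 2 (d + 1). Slicing the vertices by their load-distance to
-- y gives 2 (d + 1) vertex sets separating x from y, each with at least k
-- vertices, in which every vertex occurs at most as often as its load. The loads
-- add up to twice the size of the cut, so k (d + 1) is at most that size.

open import Defs hiding (sym)
open import Data.Nat using (ℕ; _*_; _+_; _≤_)
open import Data.Sum using (_⊎_)

open import Data.Bool using (Bool; true; false; _∧_; _∨_; _xor_; not; if_then_else_)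
import Data.Bool as Bool
open import Data.Bool.ListAction using (any)
open import Data.Bool.Properties
  using (T-≡; ∧-zeroʳ; xor-comm; xor-same; ∨-zeroʳ; ¬-not; not-¬)
open import Data.Fin using (Fin; zero; suc; toℕ; _≟_)
open import Data.Fin.Properties using (any?; sequence; toℕ-injective; toℕ<n)
open import Data.List using (allFin)
open import Data.List.Membership.Propositional using (lose)
open import Data.List.Membership.Propositional.Properties using (∈-allFin)
open import Data.List.Relation.Unary.Any using (satisfied)
open import Data.List.Relation.Unary.Any.Properties using (any⁺; any⁻)
open import Data.Nat using (zero; suc; _∸_; _<_; z≤n; s≤s; _≤?_; _<ᵇ_)
import Data.Nat as ℕ
open import Data.Nat.Induction using (<-rec)
open import Data.Nat.Properties hiding (_≟_)
open import Algebra.Properties.CommutativeMonoid.Sum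
  +-0-commutativeMonoid
  using (sum; sum-cong-≗; ∑-distrib-+; ∑-comm)
open import Data.Nat.Tactic.RingSolver using (solve-∀)
open import Data.Product using (Σ; ∃; _×_; _,_; proj₁; proj₂)
open import Data.Sum using (inj₁; inj₂)
open import Effect.Monad using (RawMonad)
open import Function using (_∘_; Equivalence; case_of_)
open import Relation.Binary.PropositionalEquality
  using (_≡_; _≢_; refl; sym; trans; cong; cong₂; subst; module ≡-Reasoning)
open import Relation.Nullary using (¬_; Dec; yes; no; contradiction; ¬¬-excluded-middle)
open import Relation.Nullary.Decidable using (decidable-stable; ⌊_⌋; _×-dec_)
open import Relation.Nullary.Negation using (¬¬-Monad)

private
  variable
    n : ℕ

-- Finite sums and counting.

ind : Bool → ℕ
ind b = if b then 1 else 0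

sum-mono : (f g : Fin n → ℕ) → (∀ i → f i ≤ g i) → sum f ≤ sum g
sum-mono {zero}  f g f≤g = z≤n
sum-mono {suc n} f g f≤g = +-mono-≤ (f≤g zero) (sum-mono (f ∘ suc) (g ∘ suc) (f≤g ∘ suc))

term≤sum : (f : Fin n → ℕ) → ∀ i → f i ≤ sum f
term≤sum f zero    = m≤m+n _ _
term≤sum f (suc i) = ≤-trans (term≤sum (f ∘ suc) i) (m≤n+m _ _)

sum-const : ∀ n c → sum {n} (λ _ → c) ≡ n * c
sum-const zero    c = refl
sum-const (suc n) c = cong (c +_) (sum-const n c)

sum-point : ∀ {n} (i : Fin n) c → sum (λ j → if ⌊ i ≟ j ⌋ then c else 0) ≡ c
sum-point {suc n} zero    c = trans (cong (c +_) (trans (sum-const n 0) (*-zeroʳ n))) (+-identityʳ c)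
sum-point {suc n} (suc i) c = trans (sum-cong-≗ step-suc) (sum-point i c)
  where
  step-suc : ∀ j → (if ⌊ Fin.suc i ≟ suc j ⌋ then c else 0) ≡ (if ⌊ i ≟ j ⌋ then c else 0)
  step-suc j with i ≟ j
  ... | yes _ = refl
  ... | no _  = refl

countB≡sum : (p : Fin n → Bool) → countB p ≡ sum (ind ∘ p)
countB≡sum {zero}  p = refl
countB≡sum {suc n} p = cong (ind (p zero) +_) (countB≡sum (p ∘ suc))

ind-mono : ∀ {a b} → (a ≡ true → b ≡ true) → ind a ≤ ind b
ind-mono {false} h = z≤n
ind-mono {true} {b} h rewrite h refl = ≤-refl

countB-mono : (p q : Fin n → Bool) → (∀ i → p i ≡ true → q i ≡ true) → countB p ≤ countB q
countB-mono p q h rewrite countB≡sum p | countB≡sum q = sum-mono _ _ (ind-mono ∘ h)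

countB-≥1 : (p : Fin n → Bool) → ∀ {i} → p i ≡ true → 1 ≤ countB p
countB-≥1 p {i} pi = ≤-trans (≤-reflexive (cong ind (sym pi)))
  (subst (ind (p i) ≤_) (sym (countB≡sum p)) (term≤sum (ind ∘ p) i))

countB-split : (p q : Fin n → Bool) →
  countB p ≡ countB (λ i → p i ∧ not (q i)) + countB (λ i → p i ∧ q i)
countB-split p q = begin
  countB p                                                       ≡⟨ countB≡sum p ⟩
  sum (ind ∘ p)                                                  ≡⟨ sum-cong-≗ (λ i → split (p i) (q i)) ⟩
  sum (λ i → ind (p i ∧ not (q i)) + ind (p i ∧ q i))            ≡⟨ ∑-distrib-+ (λ i → ind (p i ∧ not (q i))) (λ i → ind (p i ∧ q i)) ⟩
  sum (λ i → ind (p i ∧ not (q i))) + sum (λ i → ind (p i ∧ q i)) ≡⟨ cong₂ _+_ (countB≡sum (λ i → p i ∧ not (q i))) (countB≡sum (λ i → p i ∧ q i)) ⟨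
  countB (λ i → p i ∧ not (q i)) + countB (λ i → p i ∧ q i)      ∎
  where
  open ≡-Reasoning
  split : ∀ a b → ind a ≡ ind (a ∧ not b) + ind (a ∧ b)
  split false b     = refl
  split true  false = refl
  split true  true  = refl

half-mono : ∀ {a b} → a + a ≤ b + b → a ≤ b
half-mono h = ≮⇒≥ λ b<a → <⇒≱ (+-mono-< b<a b<a) h

∧-true : ∀ {a b} → a ∧ b ≡ true → a ≡ true × b ≡ true
∧-true {true} {true} _ = refl , refl

∧-intro : ∀ {a b} → a ≡ true → b ≡ true → a ∧ b ≡ true
∧-intro refl refl = refl

-- Edge counts and degree sums.

up : Adj n → Fin n → ℕ
up R u = countB (λ v → R u v ∧ (toℕ u <ᵇ toℕ v))

-- The summation inside edgeCount is local to its where block and takes the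
-- number of vertices twice, as a parameter and as the length of the sum. The
-- two with-abstractions separate these, so that the hole in the type of
-- local-sum is solved by that summation.
edgeCount≡sum : (R : Adj n) → edgeCount R ≡ sum (up R)
local-sum : (R : Adj n) → ∀ {m} (f : Fin m → ℕ) → _ ≡ sum f

edgeCount≡sum {zero}  R = refl
edgeCount≡sum {suc m} R with up R zero | (λ i → up R (suc i))
... | a | g with suc m | R
...   | n | R′ = cong (a +_) (local-sum R′ g)

local-sum R {zero}  f = refl
local-sum R {suc m} f = cong (f zero +_) (local-sum R (f ∘ suc))

<ᵇ-split : ∀ a b → a ≢ b → ind (a <ᵇ b) + ind (b <ᵇ a) ≡ 1
<ᵇ-split zero    zero    a≢b = contradiction refl a≢b
<ᵇ-split zero    (suc b) a≢b = refl
<ᵇ-split (suc a) zero    a≢b = refl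
<ᵇ-split (suc a) (suc b) a≢b = <ᵇ-split a b (a≢b ∘ cong suc)

-- `edgeCount` counts the adjacent pairs that increase. An ordered adjacent pair or its reverse
-- increases, never both.
handshake : (R : Adj n) → (∀ u v → R u v ≡ R v u) → (∀ u → R u u ≡ false) →
  sum (deg R) ≡ edgeCount R + edgeCount R
handshake R R-sym R-irrefl = begin
  sum (deg R)                                                  ≡⟨ sum-cong-≗ (λ u → countB≡sum (R u)) ⟩
  sum (λ u → sum (λ v → ind (R u v)))                          ≡⟨ sum-cong-≗ (λ u → sum-cong-≗ (split u)) ⟩
  sum (λ u → sum (λ v → below u v + below v u))                ≡⟨ sum-cong-≗ (λ u → ∑-distrib-+ (below u) (λ v → below v u)) ⟩
  sum (λ u → sum (below u) + sum (λ v → below v u))            ≡⟨ ∑-distrib-+ (λ u → sum (below u)) (λ u → sum (λ v → below v u)) ⟩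
  sum (λ u → sum (below u)) + sum (λ u → sum (λ v → below v u)) ≡⟨ cong (sum (λ u → sum (below u)) +_) (∑-comm (λ u v → below v u)) ⟩
  sum (λ u → sum (below u)) + sum (λ u → sum (below u))        ≡⟨ cong₂ _+_ count count ⟨
  edgeCount R + edgeCount R                                    ∎
  where
  open ≡-Reasoning
  below : Fin _ → Fin _ → ℕ
  below u v = ind (R u v ∧ (toℕ u <ᵇ toℕ v))

  count : edgeCount R ≡ sum (λ u → sum (below u))
  count = trans (edgeCount≡sum R) (sum-cong-≗ (λ u → countB≡sum (λ v → R u v ∧ (toℕ u <ᵇ toℕ v))))

  split : ∀ u v → ind (R u v) ≡ below u v + below v u
  split u v rewrite R-sym v u with R u v in eq
  ... | false = refl
  ... | true  = sym (<ᵇ-split (toℕ u) (toℕ v) λ e →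
    not-¬ (R-irrefl u) (subst (λ w → R u w ≡ true) (sym (toℕ-injective e)) eq))

-- Choice and minima under double negation.

¬¬-sequence : {P : Fin n → Set} → (∀ i → ¬ ¬ P i) → ¬ ¬ (∀ i → P i)
¬¬-sequence = sequence (RawMonad.rawApplicative ¬¬-Monad)

-- If no minimum exists, every `w` has some `w′` of smaller value, an infinite descent. The double
-- negation remains because `W`, later a type of walks, cannot be searched.
¬¬-argmin : {W : Set} (f : W → ℕ) → W → ¬ ¬ (∃ λ w → ∀ w′ → f w ≤ f w′)
¬¬-argmin {W} f w₀ = <-rec Minimum descend (f w₀) w₀ refl
  where
  Minimum : ℕ → Set
  Minimum m = ∀ w → f w ≡ m → ¬ ¬ (∃ λ w → ∀ w′ → f w ≤ f w′)
  descend : ∀ m → (∀ {j} → j < m → Minimum j) → Minimum m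
  descend _ rec w refl none = none (w , λ w′ → ≮⇒≥ λ w′<w → rec w′<w w′ refl none)

-- Weighted walks and separating layers.

Walk : Adj n → Fin n → Fin n → Set
Walk A = Reach (λ x y → A x y ≡ true)

-- Both ends count, and a repeated vertex counts at each visit, so lower bounds only need distinct
-- positions on the walk.
weight : {E : Fin n → Fin n → Set} → (Fin n → ℕ) → ∀ {u v} → Reach E u v → ℕ
weight ℓ (here {u})     = ℓ u
weight ℓ (step {u} _ r) = ℓ u + weight ℓ r

first≤weight : {E : Fin n → Fin n → Set} (ℓ : Fin n → ℕ) → ∀ {u v} (r : Reach E u v) → ℓ u ≤ weight ℓ r
first≤weight ℓ here       = ≤-refl
first≤weight ℓ (step _ r) = m≤m+n _ _

snoc : {E : Fin n → Fin n → Set} → ∀ {u v w} → Reach E u v → E v w → Reach E u w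
snoc here       e = step e here
snoc (step f r) e = step f (snoc r e)

inInterval : ℕ → ℕ → ℕ → Bool
inInterval a b t = (a <ᵇ suc t) ∧ (t <ᵇ b)

inInterval⁺ : ∀ {a b t} → a ≤ t → t < b → inInterval a b t ≡ true
inInterval⁺ a≤t t<b = ∧-intro (Equivalence.to T-≡ (<⇒<ᵇ (s≤s a≤t))) (Equivalence.to T-≡ (<⇒<ᵇ t<b))

inInterval⁻ : ∀ {a b t} → inInterval a b t ≡ true → a ≤ t × t < b
inInterval⁻ {a} {b} {t} h with ∧-true h
... | p , q = ≤-pred (<ᵇ⇒< a (suc t) (Equivalence.from T-≡ p)) , <ᵇ⇒< t b (Equivalence.from T-≡ q)

count-interval : ∀ m a b → sum {m} (λ t → ind (inInterval a b (toℕ t))) ≤ b ∸ a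
count-interval zero    a       b       = z≤n
count-interval (suc m) zero    zero    = ≤-reflexive (trans (sum-const m 0) (*-zeroʳ m))
count-interval (suc m) (suc a) zero    = ≤-trans
  (≤-reflexive (sum-cong-≗ {m} λ i → cong ind (∧-zeroʳ (a <ᵇ suc (toℕ i)))))
  (≤-reflexive (trans (sum-const m 0) (*-zeroʳ m)))
count-interval (suc m) zero    (suc b) = s≤s (count-interval m zero b)
count-interval (suc m) (suc a) (suc b) = count-interval m a b

-- An integral form of the easy direction of weighted Menger duality: with D v
-- the least weight of a walk from v to y, each layer {v : D v ∸ ℓ v ≤ t < D v}
-- separates x from y, and v lies in at most ℓ v of the layers.
weighted-separation : (A : Adj n) → Connected A →
  ∀ {k} → (∀ S → Separates A S → k ≤ countB S) →
  (ℓ : Fin n → ℕ) → ∀ {x y} → ℓ x ≡ 0 → ℓ y ≡ 0 →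
  ∀ {m} → (∀ (r : Walk A x y) → m ≤ weight ℓ r) →
  m * k ≤ sum ℓ
weighted-separation {n} A conn {k} k-min ℓ {x} {y} ℓx ℓy {m} heavy =
  -- Lightest walks are available only under double negation, which suffices for a decidable
  -- inequality.
  decidable-stable (_ ≤? _) λ ¬goal →
    ¬¬-sequence (λ v → ¬¬-argmin (weight ℓ) (conn v y)) (¬goal ∘ bound)
  where
  bound : (∀ v → ∃ λ (r : Walk A v y) → ∀ r′ → weight ℓ r ≤ weight ℓ r′) → m * k ≤ sum ℓ
  bound lightest = begin
    m * k                                        ≡⟨ sum-const m k ⟨
    sum {m} (λ _ → k)                            ≤⟨ sum-mono _ _ (λ t → k-min (layer t) (inj₁ (separated t))) ⟩
    sum (λ t → countB (layer t))                 ≡⟨ sum-cong-≗ (λ t → countB≡sum (layer t)) ⟩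
    sum (λ t → sum (λ v → ind (layer t v)))      ≡⟨ ∑-comm (λ t v → ind (layer t v)) ⟩
    sum (λ v → sum (λ t → ind (layer t v)))      ≤⟨ sum-mono _ _ (λ v → count-interval m (D v ∸ ℓ v) (D v)) ⟩
    sum (λ v → D v ∸ (D v ∸ ℓ v))                ≤⟨ sum-mono _ _ (λ v → m∸[m∸n]≤n (D v) (ℓ v)) ⟩
    sum ℓ                                        ∎
    where
    open ≤-Reasoning
    m∸[m∸n]≤n : ∀ a b → a ∸ (a ∸ b) ≤ b
    m∸[m∸n]≤n a b = ≤-trans (∸-monoˡ-≤ (a ∸ b) (m≤n+m∸n a b)) (≤-reflexive (m+n∸n≡m b (a ∸ b)))

    D : Fin n → ℕ
    D v = weight ℓ (proj₁ (lightest v))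

    D-step : ∀ {u v} → A u v ≡ true → D u ≤ ℓ u + D v
    D-step {u} {v} e = proj₂ (lightest u) (step e (proj₁ (lightest v)))

    layer : Fin m → Fin n → Bool
    layer t v = inInterval (D v ∸ ℓ v) (D v) (toℕ t)

    weightless : ∀ t {v} → ℓ v ≡ 0 → layer t v ≡ false
    weightless t {v} ℓv = ¬-not λ h → case inInterval⁻ h of λ
      { (lo , hi) → <-irrefl refl (<-≤-trans hi (subst (λ c → D v ∸ c ≤ toℕ t) ℓv lo)) }

    -- One step lowers `D` by at most `ℓ u`. A step from above `t` to `t` or below would therefore
    -- start inside the layer.
    stays-high : ∀ t {u v} → ReachAvoiding A (layer t) u v → toℕ t < D u → toℕ t < D v
    stays-high t here h = h
    stays-high t (step {u} {w} (e , u∉ , _) r) h = stays-high t r (≰⇒> λ Dw≤t →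
      not-¬ u∉ (inInterval⁺ (≤-trans (m≤n+o⇒m∸n≤o (D u) (ℓ u) (D-step e)) Dw≤t) h))

    separated : ∀ t → Σ (Fin n) λ u → Σ (Fin n) λ v →
      (layer t u ≡ false) × (layer t v ≡ false) × ¬ ReachAvoiding A (layer t) u v
    separated t = x , y , weightless t ℓx , weightless t ℓy , λ r →
      -- `D x` is at least `m`, hence above `t`, whereas `D y` is 0 by the trivial walk.
      n≮0 (<-≤-trans (stays-high t r (<-≤-trans (toℕ<n t) (heavy (proj₁ (lightest x)))))
        (≤-trans (proj₂ (lightest y) here) (≤-reflexive ℓy)))

-- Adjacency in the square.

module _ (G : Graph n) where

  private
    A = adj G
    H = square A

  TwoStep : Fin n → Fin n → Set
  TwoStep u v = A u v ≡ true ⊎ ∃ λ w → A u w ≡ true × A w v ≡ true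

  square⁺ : ∀ {u v} → u ≢ v → TwoStep u v → H u v ≡ true
  square⁺ {u} {v} u≢v near with u ≟ v
  ... | yes u≡v = contradiction u≡v u≢v
  ... | no _ = go near
    where
    go : TwoStep u v → A u v ∨ any (λ w → A u w ∧ A w v) (allFin n) ≡ true
    go (inj₁ uv) rewrite uv = refl
    go (inj₂ (w , uw , wv)) = trans
      (cong (A u v ∨_) (Equivalence.to T-≡ (any⁺ (λ w → A u w ∧ A w v)
        (lose (∈-allFin w) (Equivalence.from T-≡ (∧-intro uw wv))))))
      (∨-zeroʳ (A u v))

  square⁻ : ∀ {u v} → H u v ≡ true → u ≢ v × TwoStep u v
  square⁻ {u} {v} h with u ≟ v
  ... | no u≢v = u≢v , go h
    where
    go : A u v ∨ any (λ w → A u w ∧ A w v) (allFin n) ≡ true → TwoStep u v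
    go h with A u v
    ... | true = inj₁ refl
    ... | false with satisfied (any⁻ (λ w → A u w ∧ A w v) (allFin n) (Equivalence.from T-≡ h))
    ...   | w , uwv = inj₂ (w , ∧-true (Equivalence.to T-≡ uwv))

  square-irrefl : ∀ u → H u u ≡ false
  square-irrefl u = ¬-not λ h → proj₁ (square⁻ h) refl

  adj-sym : ∀ {u v} → A u v ≡ true → A v u ≡ true
  adj-sym {u} {v} = trans (Graph.sym G v u)

  square-sym⁺ : ∀ {u v} → H u v ≡ true → H v u ≡ true
  square-sym⁺ h with square⁻ h
  ... | u≢v , inj₁ uv              = square⁺ (u≢v ∘ sym) (inj₁ (adj-sym uv))
  ... | u≢v , inj₂ (w , uw , wv) = square⁺ (u≢v ∘ sym) (inj₂ (w , adj-sym wv , adj-sym uw))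

  square-sym : ∀ u v → H u v ≡ H v u
  square-sym u v with H u v in p | H v u in q
  ... | true  | true  = refl
  ... | false | false = refl
  ... | true  | false = trans (sym (square-sym⁺ p)) q
  ... | false | true  = trans (sym p) (square-sym⁺ q)




  -- Cuts of the square and their loads.

  module Cut (s : Fin n → Bool) where

    crossing : Adj n
    crossing u v = H u v ∧ (s u xor s v)

    load : Fin n → ℕ
    load = deg crossing

    crossing-sym : ∀ u v → crossing u v ≡ crossing v u
    crossing-sym u v = cong₂ _∧_ (square-sym u v) (xor-comm (s u) (s v))

    crossing-irrefl : ∀ u → crossing u u ≡ false
    crossing-irrefl u rewrite square-irrefl u = refl

    xor⇒≢ : ∀ {u v} → s u xor s v ≡ true → u ≢ v
    xor⇒≢ {u} h refl = not-¬ (xor-same (s u)) h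

    twoStep⇒crossing : ∀ {u v} → TwoStep u v → s u xor s v ≡ true → crossing u v ≡ true
    twoStep⇒crossing near h = ∧-intro (square⁺ (xor⇒≢ h) near) h

    -- The side is constant along every walk without crossing edges.
    crossing-disconnects : ∀ {u v} → s u xor s v ≡ true → ¬ Connected (removeEdges H crossing)
    crossing-disconnects {u} {v} h conn = not-¬ (subst (λ c → s u xor c ≡ false) (constant (conn u v)) (xor-same (s u))) h
      where
      same : ∀ a b c → a ∧ not (a ∧ (b xor c)) ≡ true → b ≡ c
      same true true  true  _ = refl
      same true false false _ = refl

      constant : ∀ {p q} → Walk (removeEdges H crossing) p q → s p ≡ s q
      constant here       = refl
      constant (step {p} {q} e r) = trans (same (H p q) (s p) (s q) e) (constant r)

    -- This is the size of the cut, since each cut edge has exactly one end on side `b`.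
    sideLoad : Bool → ℕ
    sideLoad b = sum (λ v → if ⌊ s v Bool.≟ b ⌋ then load v else 0)

    sideLoad-not : ∀ b → sideLoad b ≡ sideLoad (not b)
    sideLoad-not b = begin
      sideLoad b                                                       ≡⟨ sum-cong-≗ (expand b) ⟩
      sum (λ v → sum (λ w → ind (⌊ s v Bool.≟ b ⌋ ∧ crossing v w)))     ≡⟨ sum-cong-≗ (λ v → sum-cong-≗ (flip b v)) ⟩
      sum (λ v → sum (λ w → ind (⌊ s w Bool.≟ not b ⌋ ∧ crossing w v))) ≡⟨ ∑-comm (λ v w → ind (⌊ s w Bool.≟ not b ⌋ ∧ crossing w v)) ⟩
      sum (λ w → sum (λ v → ind (⌊ s w Bool.≟ not b ⌋ ∧ crossing w v))) ≡⟨ sum-cong-≗ (expand (not b)) ⟨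
      sideLoad (not b)                                                 ∎
      where
      open ≡-Reasoning
      expand : ∀ c v → (if ⌊ s v Bool.≟ c ⌋ then load v else 0) ≡ sum (λ w → ind (⌊ s v Bool.≟ c ⌋ ∧ crossing v w))
      expand c v with ⌊ s v Bool.≟ c ⌋
      ... | true  = countB≡sum (crossing v)
      ... | false = sym (trans (sum-const n 0) (*-zeroʳ n))

      opposite : ∀ b a p q → ⌊ p Bool.≟ b ⌋ ∧ a ∧ (p xor q) ≡ ⌊ q Bool.≟ not b ⌋ ∧ a ∧ (q xor p)
      opposite false false false false = refl
      opposite false false false true  = refl
      opposite false false true  false = refl
      opposite false false true  true  = refl
      opposite false true  false false = refl
      opposite false true  false true  = refl
      opposite false true  true  false = refl
      opposite false true  true  true  = refl
      opposite true  false false false = refl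
      opposite true  false false true  = refl
      opposite true  false true  false = refl
      opposite true  false true  true  = refl
      opposite true  true  false false = refl
      opposite true  true  false true  = refl
      opposite true  true  true  false = refl
      opposite true  true  true  true  = refl

      flip : ∀ b v w → ind (⌊ s v Bool.≟ b ⌋ ∧ crossing v w) ≡ ind (⌊ s w Bool.≟ not b ⌋ ∧ crossing w v)
      flip b v w rewrite square-sym w v = cong ind (opposite b (H v w) (s v) (s w))

    sum-load : ∀ b → sum load ≡ sideLoad b + sideLoad b
    sum-load b = begin
      sum load                      ≡⟨ sum-cong-≗ (λ v → split (load v) (s v) b) ⟩
      sum (λ v → (if ⌊ s v Bool.≟ b ⌋ then load v else 0) + (if ⌊ s v Bool.≟ not b ⌋ then load v else 0))
                                    ≡⟨ ∑-distrib-+ (λ v → if ⌊ s v Bool.≟ b ⌋ then load v else 0) _ ⟩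
      sideLoad b + sideLoad (not b) ≡⟨ cong (sideLoad b +_) (sideLoad-not b) ⟨
      sideLoad b + sideLoad b       ∎
      where
      open ≡-Reasoning
      split : ∀ c a b → c ≡ (if ⌊ a Bool.≟ b ⌋ then c else 0) + (if ⌊ a Bool.≟ not b ⌋ then c else 0)
      split c true  true  = sym (+-identityʳ c)
      split c true  false = refl
      split c false true  = refl
      split c false false = sym (+-identityʳ c)

    edgeCount-crossing : ∀ b → edgeCount crossing ≤ sideLoad b
    edgeCount-crossing b = half-mono (≤-reflexive
      (trans (sym (handshake crossing crossing-sym crossing-irrefl)) (sum-load b)))

    -- If every vertex on side b carried a crossing edge, a vertex v of side b
    -- could injectively trade its neighbours on its own side for crossing edges
    -- at those neighbours, and the cut would have at least deg v edges.
    interior : ∀ {b l} → sideLoad b ≤ l → (∀ u → l < deg H u) →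
      ∀ {v} → s v ≡ b → ∃ λ x → s x ≡ b × load x ≡ 0
    interior {b} {l} small l<deg {v} sv
      with any? (λ x → (s x Bool.≟ b) ×-dec (load x ℕ.≟ 0))
    ... | yes found = found
    ... | no none   = contradiction (l<deg v) (≤⇒≯ (begin
      deg H v
        ≡⟨ countB-split (H v) (λ u → s v xor s u) ⟩
      countB stay + load v
        ≡⟨ cong₂ _+_ (countB≡sum stay) (sym (sum-point v (load v))) ⟩
      sum (ind ∘ stay) + sum (λ u → if ⌊ v ≟ u ⌋ then load v else 0)
        ≡⟨ ∑-distrib-+ (ind ∘ stay) (λ u → if ⌊ v ≟ u ⌋ then load v else 0) ⟨
      sum (λ u → ind (stay u) + (if ⌊ v ≟ u ⌋ then load v else 0))
        ≤⟨ sum-mono _ _ trade ⟩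
      sideLoad b
        ≤⟨ small ⟩
      l ∎))
      where
      open ≤-Reasoning
      stay : Fin n → Bool
      stay u = H v u ∧ not (s v xor s u)

      same : ∀ a b → not (a xor b) ≡ true → b ≡ a
      same true  true  _ = refl
      same false false _ = refl

      onSide : ∀ {u} → s u ≡ b → load u ≤ (if ⌊ s u Bool.≟ b ⌋ then load u else 0)
      onSide {u} su with s u Bool.≟ b
      ... | yes _ = ≤-refl
      ... | no su≢b = contradiction su su≢b

      exchange : ∀ {p u} → (p ≡ true → s u ≡ b) → ind p ≤ (if ⌊ s u Bool.≟ b ⌋ then load u else 0)
      exchange {false}     h = z≤n
      exchange {true}  {u} h = ≤-trans (n≢0⇒n>0 (λ z → none (u , h refl , z))) (onSide (h refl))

      trade : ∀ u → ind (stay u) + (if ⌊ v ≟ u ⌋ then load v else 0)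
        ≤ (if ⌊ s u Bool.≟ b ⌋ then load u else 0)
      trade u with v ≟ u
      -- Matching on `v ≟ u` also evaluates the factor `not ⌊ v ≟ u ⌋` of `H v u`, so `stay`
      -- vanishes at `v`.
      ... | yes refl = onSide sv
      ... | no _     = ≤-trans (≤-reflexive (+-identityʳ _))
        (exchange λ h → trans (same (s v) (s u) (proj₂ (∧-true h))) sv)

    -- Cut edges at u reach the neighbours of w on the other side; those at z
    -- reach w and the neighbours of w on its own side.
    deg<load+load : ∀ {u w z} → A u w ≡ true → A w z ≡ true →
      s u ≡ s w → s w xor s z ≡ true → deg A w < load u + load z
    deg<load+load {u} {w} {z} uw wz su wz-crosses = begin-strict
      deg A w              ≡⟨ countB-split (A w) (λ v → s w xor s v) ⟩
      countB own + countB other <⟨ +-mono-<-≤ own<load other≤load ⟩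
      load z + load u      ≡⟨ +-comm (load z) (load u) ⟩
      load u + load z      ∎
      where
      open ≤-Reasoning
      own other : Fin n → Bool
      own   v = A w v ∧ not (s w xor s v)
      other v = A w v ∧ (s w xor s v)

      other≤load : countB other ≤ load u
      other≤load = countB-mono other (crossing u) λ v h → case ∧-true h of λ
        { (wv , cross) → twoStep⇒crossing (inj₂ (w , uw , wv)) (trans (cong (_xor s v) su) cross) }

      flip : ∀ a b c → a xor c ≡ true → not (a xor b) ≡ true → c xor b ≡ true
      flip true  true  false _ _ = refl
      flip false false true  _ _ = refl

      -- The vertex `w` makes the bound strict: it is not its own neighbour, yet a cut edge joins it
      -- to `z`.
      closed : ∀ v → (if ⌊ w ≟ v ⌋ then 1 else 0) + ind (own v) ≤ ind (crossing z v)
      closed v with w ≟ v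
      ... | yes refl rewrite irrefl G w = ≤-reflexive (cong ind (sym
        (twoStep⇒crossing (inj₁ (adj-sym wz)) (trans (xor-comm (s z) (s w)) wz-crosses))))
      ... | no _ = ind-mono λ h → case ∧-true h of λ
        { (wv , stay) → twoStep⇒crossing (inj₂ (w , adj-sym wz , wv)) (flip (s w) (s v) (s z) wz-crosses stay) }

      own<load : countB own < load z
      own<load = begin-strict
        countB own <⟨ n<1+n _ ⟩
        suc (countB own) ≡⟨ cong₂ _+_ (sum-point w 1) (sym (countB≡sum own)) ⟨
        sum (λ v → if ⌊ w ≟ v ⌋ then 1 else 0) + sum (ind ∘ own) ≡⟨ ∑-distrib-+ (λ v → if ⌊ w ≟ v ⌋ then 1 else 0) (ind ∘ own) ⟨
        sum (λ v → (if ⌊ w ≟ v ⌋ then 1 else 0) + ind (own v)) ≤⟨ sum-mono _ _ closed ⟩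
        sum (ind ∘ crossing z) ≡⟨ countB≡sum (crossing z) ⟨
        load z ∎

    -- Weight of walks between unloaded vertices.

    module _ {d} (d≤deg : ∀ v → d ≤ deg A v) where

      turn : ∀ {u w z} → A u w ≡ true → A w z ≡ true →
        s u ≡ s w → s w xor s z ≡ true → suc d ≤ load u + load z
      turn uw wz su sz = ≤-trans (s≤s (d≤deg _)) (deg<load+load uw wz su sz)

      unloaded : ∀ {u v} → load u ≡ 0 → A u v ≡ true → s u ≡ s v
      unloaded {u} {v} u0 uv = same (s u) (s v) (¬-not λ cross →
        n≮0 (subst (1 ≤_) u0 (countB-≥1 (crossing u) (twoStep⇒crossing (inj₁ uv) cross))))
        where
        same : ∀ a b → a xor b ≡ false → a ≡ b
        same true  true  _ = refl
        same false false _ = refl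

      module _ {y} (y0 : load y ≡ 0) (sy : s y ≡ false) where

        final-turn : ∀ {p} → s p ≡ true → (r : Walk A p y) → suc d ≤ weight load r
        -- The summand `load q` sets the first vertex of `r` aside: `first-crossing` spends its load
        -- on the earlier turn, so the later turn must do without it.
        last-crossing : ∀ {p q} → A p q ≡ true → s p ≡ true → s q ≡ false →
          (r : Walk A q y) → load q + suc d ≤ load p + weight load r

        final-turn sp here = contradiction sp (not-¬ sy)
        final-turn sp (step {p} {q} pq r) with s q in sq
        ... | true  = ≤-trans (final-turn sq r) (m≤n+m _ (load p))
        ... | false = ≤-trans (m≤n+m _ (load q)) (last-crossing pq sp sq r)

        -- Here `q` is `y`, and the edge from `p` would load it.
        last-crossing pq sp sq here = contradiction
          (trans (sym (unloaded y0 (adj-sym pq))) sy) (not-¬ sp)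
        last-crossing {p} {q} pq sp sq (step {w = t} qt r) with s t in st
        ... | true  = ≤-trans (+-monoʳ-≤ (load q) (final-turn st r)) (m≤n+m _ (load p))
        ... | false = begin
          load q + suc d                         ≤⟨ +-monoʳ-≤ (load q) (turn (adj-sym qt) (adj-sym pq) (trans st (sym sq)) (cong₂ _xor_ sq sp)) ⟩
          load q + (load t + load p)             ≡⟨ rearrange (load q) (load t) (load p) ⟩
          load p + (load q + load t)             ≤⟨ +-monoʳ-≤ (load p) (+-monoʳ-≤ (load q) (first≤weight load r)) ⟩
          load p + (load q + weight load r)      ∎
          where
          open ≤-Reasoning
          rearrange : ∀ a b c → a + (b + c) ≡ c + (a + b)
          rearrange = solve-∀

        first-crossing : ∀ {u w} → A u w ≡ true → s u ≡ true → s w ≡ true →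
          (r : Walk A w y) → suc d + suc d ≤ load u + weight load r
        first-crossing uw su sw here = contradiction sw (not-¬ sy)
        first-crossing {u} {w} uw su sw (step {w = z} wz r) with s z in sz
        ... | true  = ≤-trans (first-crossing wz sw sz r) (m≤n+m _ (load u))
        ... | false = begin
          suc d + suc d                     ≤⟨ +-monoˡ-≤ (suc d) (turn uw wz (trans su (sym sw)) (cong₂ _xor_ sw sz)) ⟩
          load u + load z + suc d           ≡⟨ +-assoc (load u) (load z) (suc d) ⟩
          load u + (load z + suc d)         ≤⟨ +-monoʳ-≤ (load u) (last-crossing wz sw sz r) ⟩
          load u + (load w + weight load r) ∎
          where open ≤-Reasoning

        walk-weight : ∀ {x} → load x ≡ 0 → s x ≡ true → (r : Walk A x y) → suc d + suc d ≤ weight load r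
        walk-weight x0 sx here        = contradiction sx (not-¬ sy)
        -- As `x` is unloaded, the first step stays on its side, so the first crossing has a
        -- predecessor on that side.
        walk-weight x0 sx (step xw r) = first-crossing xw sx (trans (sym (unloaded x0 xw)) sx) r

  -- Bounds on the edge-connectivity of the square.

  edgeConn≤deg : ∀ {l} → IsEdgeConn H l → ∀ u → 1 ≤ deg A u → l ≤ deg H u
  edgeConn≤deg {l} (_ , l-min) u 1≤deg = begin
    l                  ≤⟨ l-min crossing ((λ p q h → proj₁ (∧-true h)) , crossing-sym) (crossing-disconnects cross) ⟩
    edgeCount crossing ≤⟨ edgeCount-crossing true ⟩
    sideLoad true      ≡⟨ sum-cong-≗ (λ v → only-u (u ≟ v)) ⟩
    sum (λ v → if ⌊ u ≟ v ⌋ then load u else 0) ≡⟨ sum-point u (load u) ⟩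
    load u             ≤⟨ countB-mono (crossing u) (H u) (λ v h → proj₁ (∧-true h)) ⟩
    deg H u            ∎
    where
    open ≤-Reasoning
    -- The cut isolates `u`; a neighbour of `u` shows that the other side is inhabited.
    open Cut (λ v → ⌊ u ≟ v ⌋)

    only-u : ∀ {v} (u≟v : Dec (u ≡ v)) →
      (if ⌊ ⌊ u≟v ⌋ Bool.≟ true ⌋ then load v else 0) ≡ (if ⌊ u≟v ⌋ then load u else 0)
    only-u (yes refl) = refl
    only-u (no _)     = refl

    countB-witness : ∀ {m} (p : Fin m → Bool) → 1 ≤ countB p → ∃ λ i → p i ≡ true
    countB-witness {suc m} p h with p zero in eq
    ... | true  = zero , eq
    ... | false with countB-witness (p ∘ suc) h
    ...   | i , pi = suc i , pi

    neighbour : ∃ λ v → A u v ≡ true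
    neighbour = countB-witness (A u) 1≤deg

    cross : ⌊ u ≟ u ⌋ xor ⌊ u ≟ proj₁ neighbour ⌋ ≡ true
    cross with u ≟ u | u ≟ proj₁ neighbour
    ... | no u≢u | _ = contradiction refl u≢u
    ... | yes _  | no _ = refl
    ... | yes _  | yes u≡v = contradiction (subst (λ w → A u w ≡ true) (sym u≡v) (proj₂ neighbour)) (not-¬ (irrefl G u))

  -- One side consists of the vertices still reachable from a fixed vertex. Every edge leaving it
  -- lies in `R`, so the loads add up to at most twice `edgeCount R`, and the degree bound gives
  -- both sides an unloaded vertex.
  large-cut : Connected A → ∀ {d} → (∀ v → d ≤ deg A v) →
    ∀ {k} → (∀ S → Separates A S → k ≤ countB S) →
    ∀ R → IsEdgeSet H R → ¬ Connected (removeEdges H R) →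
    (∀ u → edgeCount R < deg H u) → k * (d + 1) ≤ edgeCount R
  large-cut conn {d} d≤deg {k} k-min R (R⊆H , R-sym) ¬conn R<deg =
    decidable-stable (_ ≤? _) λ ¬goal →
      -- Both a separated pair `u`, `v` and a decision of reachability from `u` are obtained under
      -- double negation.
      ¬¬-sequence (λ u → ¬¬-sequence λ v ¬uv →
        ¬¬-sequence (λ w → ¬¬-excluded-middle) λ reach? → ¬goal (bound u v ¬uv reach?)) ¬conn
    where
    Left : Fin n → Fin n → Set
    Left = Walk (removeEdges H R)

    R-irrefl : ∀ u → R u u ≡ false
    R-irrefl u = ¬-not λ h → not-¬ (square-irrefl u) (R⊆H u u h)

    bound : ∀ u v → ¬ Left u v → (∀ w → Dec (Left u w)) → k * (d + 1) ≤ edgeCount R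
    bound u v ¬uv reach? = conclude (interior (small true) R<deg su) (interior (small false) R<deg sv)
      where
      open Cut (λ w → ⌊ reach? w ⌋)

      su : ⌊ reach? u ⌋ ≡ true
      su with reach? u
      ... | yes _ = refl
      ... | no ¬uu = contradiction here ¬uu

      sv : ⌊ reach? v ⌋ ≡ false
      sv with reach? v
      ... | yes uv = contradiction uv ¬uv
      ... | no _   = refl

      leaving : ∀ {p q} → Left u p → ¬ Left u q → H p q ≡ true → R p q ≡ true
      leaving {p} {q} up ¬uq pq with R p q in eq
      ... | true  = refl
      ... | false = contradiction (snoc up (∧-intro pq (cong not eq))) ¬uq

      crossing⊆R : ∀ p q → crossing p q ≡ true → R p q ≡ true
      crossing⊆R p q h with ∧-true {H p q} h
      ... | pq , cross with reach? p | reach? q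
      ...   | yes up | no ¬uq = leaving up ¬uq pq
      ...   | no ¬up | yes uq = trans (R-sym p q) (leaving uq ¬up (square-sym⁺ pq))

      sum-load≤ : sum load ≤ edgeCount R + edgeCount R
      sum-load≤ = ≤-trans (sum-mono load (deg R) λ p → countB-mono (crossing p) (R p) (crossing⊆R p))
        (≤-reflexive (handshake R R-sym R-irrefl))

      small : ∀ b → sideLoad b ≤ edgeCount R
      small b = half-mono (≤-trans (≤-reflexive (sym (sum-load b))) sum-load≤)

      conclude : (∃ λ x → ⌊ reach? x ⌋ ≡ true × load x ≡ 0) →
        (∃ λ y → ⌊ reach? y ⌋ ≡ false × load y ≡ 0) → k * (d + 1) ≤ edgeCount R
      conclude (x , sx , x0) (y , sy , y0) = half-mono (begin
        k * (d + 1) + k * (d + 1)     ≡⟨ double k d ⟩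
        (suc d + suc d) * k           ≤⟨ weighted-separation A conn k-min load x0 y0 (walk-weight d≤deg y0 sy x0 sx) ⟩
        sum load                      ≤⟨ sum-load≤ ⟩
        edgeCount R + edgeCount R     ∎)
        where
        open ≤-Reasoning
        double : ∀ k d → k * (d + 1) + k * (d + 1) ≡ (suc d + suc d) * k
        double = solve-∀

theorem3 : ∀ (n : ℕ) (G : Graph n) → Connected (adj G)
    → (d : ℕ) → IsMinDeg (adj G) d → 2 ≤ d
    → (k : ℕ) → IsVertexConn (adj G) k
    → (l : ℕ) → IsEdgeConn (square (adj G)) l
    → MaxEdgeConnected (square (adj G)) ⊎ k * (d + 1) ≤ l
theorem3 n G conn d (_ , d≤deg) 2≤d k (_ , k-min) l l-conn@((R , R-edges , refl , ¬conn) , _)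
  -- No degree of the square is below `l`. If `l` is attained, it is the minimum degree; otherwise
  -- every degree exceeds `l`, as `large-cut` requires.
  with any? (λ u → deg (square (adj G)) u ℕ.≟ l)
... | yes attained = inj₁ (l , (attained , l≤deg) , l-conn)
  where
  l≤deg : ∀ u → l ≤ deg (square (adj G)) u
  l≤deg u = edgeConn≤deg G l-conn u (≤-trans (<⇒≤ 2≤d) (d≤deg u))
... | no ¬attained = inj₂ (large-cut G conn d≤deg k-min R R-edges ¬conn λ u →
  ≤∧≢⇒< (edgeConn≤deg G l-conn u (≤-trans (<⇒≤ 2≤d) (d≤deg u))) (λ e → ¬attained (u , sym e)))
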